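{- There exist infinitely many tuples $(a_0,a_1,a_2,a_3)$ of integers with $a_0\ge 0$, $a_1,a_2,a_3\ge 1$, $\gcd(a_0,a_1,a_2,a_3)=1$, $H(a_0;a_1,a_2,a_3)\subset\mathcal{S}$ and $a_1=a_2<a_3$. Moreover, there is a constant $c>0$ such that, for all sufficiently large $N$, the number of such tuples with $a_i\le N$ for $i=0,1,2,3$ is at least $c\,N^{1/10}$. The same statements (infinitude and the lower bound of the form $c\,N^{1/10}$ with some constant $c>0$) hold with the condition $a_1=a_2<a_3$ replaced by $a_1<a_2=a_3$.
   Context: $\mathcal{S}=\{n^2 : n\in\mathbb{N}\}$ is the set of integer squares ($\mathbb{N}$ contains $0$). The Hilbert cube of dimension $3$ is $H(a_0;a_1,a_2,a_3)=\{a_0+\varepsilon_1a_1+\varepsilon_2a_2+\varepsilon_3a_3 : \varepsilon_i\in\{0,1\}\}$. A Hilbert cube is called reduced if $\gcd(a_0,a_1,a_2,a_3)=1$. -}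

module Defs where

open import Algebra.Definitions.RawSemiring using () renaming (_^_ to pow)
open import Data.Fin using (Fin; toℕ)
open import Data.Integer using (+_)
open import Data.List using (length)
open import Data.List.Membership.Propositional using (_∈_; _∉_)
open import Data.List.Relation.Unary.Unique.Propositional using (Unique)
open import Data.Nat as ℕ using (ℕ)
open import Data.Nat.GCD using (gcd)
open import Data.Product using (∃-syntax; _×_; _,_)
open import Data.Rational as ℚ using (ℚ; 0ℚ; +-*-rawSemiring)
open import Function.Bundles using (_⇔_)
open import Level using (0ℓ)
open import Relation.Binary.PropositionalEquality using (_≡_)
open import Relation.Unary using (Pred; _⊆_; _∩_)

𝒮 : Pred ℕ 0ℓ
𝒮 x = ∃[ n ] x ≡ n ℕ.^ 2

-- (a₀ , a₁ , a₂ , a₃).  The integers considered satisfy a₀ ≥ 0 and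
-- a₁, a₂, a₃ ≥ 1, so they are taken in ℕ from the outset.
Tuple : Set
Tuple = ℕ × ℕ × ℕ × ℕ

H : Tuple → Pred ℕ 0ℓ
H (a₀ , a₁ , a₂ , a₃) x =
  ∃[ ε₁ ] ∃[ ε₂ ] ∃[ ε₃ ]
    x ≡ a₀ ℕ.+ val ε₁ ℕ.* a₁ ℕ.+ val ε₂ ℕ.* a₂ ℕ.+ val ε₃ ℕ.* a₃
  where
  val : Fin 2 → ℕ
  val = toℕ

Reduced : Pred Tuple 0ℓ
Reduced (a₀ , a₁ , a₂ , a₃) = gcd a₀ (gcd a₁ (gcd a₂ a₃)) ≡ 1

PositiveSteps : Pred Tuple 0ℓ
PositiveSteps (_ , a₁ , a₂ , a₃) = 1 ℕ.≤ a₁ × 1 ℕ.≤ a₂ × 1 ℕ.≤ a₃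

ReducedSquareCube : Pred Tuple 0ℓ
ReducedSquareCube a = PositiveSteps a × Reduced a × H a ⊆ 𝒮

FirstTwoEqual : Pred Tuple 0ℓ
FirstTwoEqual (_ , a₁ , a₂ , a₃) = a₁ ≡ a₂ × a₂ ℕ.< a₃

LastTwoEqual : Pred Tuple 0ℓ
LastTwoEqual (_ , a₁ , a₂ , a₃) = a₁ ℕ.< a₂ × a₂ ≡ a₃

BoundedBy : ℕ → Pred Tuple 0ℓ
BoundedBy N (a₀ , a₁ , a₂ , a₃) =
  a₀ ℕ.≤ N × a₁ ℕ.≤ N × a₂ ℕ.≤ N × a₃ ℕ.≤ N

Infinite : {A : Set} → Pred A 0ℓ → Set
Infinite P = ∀ xs → ∃[ x ] P x × x ∉ xs

-- P has exactly k elements: some repetition-free list of length k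
-- enumerates it.
HasSize : {A : Set} → Pred A 0ℓ → ℕ → Set
HasSize {A} P k =
  ∃[ xs ] Unique xs × (∀ (x : A) → x ∈ xs ⇔ P x) × length xs ≡ k

fromℕ : ℕ → ℚ
fromℕ n = + n ℚ./ 1

-- For c ≥ 0 this is k ≥ c · N^(1/d) (with d ≥ 1): both sides are
-- nonnegative, so the inequality may be raised to the d-th power,
-- which avoids the irrational number N^(1/d).
AtLeastRootMultiple : (d : ℕ) (c : ℚ) (N k : ℕ) → Set
AtLeastRootMultiple d c N k = (c ^ d) ℚ.* fromℕ N ℚ.≤ fromℕ k ^ d
  where
  _^_ : ℚ → ℕ → ℚ
  _^_ = pow +-*-rawSemiring

-- The number of elements of P with all aᵢ ≤ N is at least c · N^(1/d)
-- for some constant c > 0 and all sufficiently large N.  A positive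
-- real c may be decreased to a positive rational one, so taking c
-- in ℚ loses nothing.
CountAtLeastRoot : (d : ℕ) → Pred Tuple 0ℓ → Set
CountAtLeastRoot d P =
  ∃[ c ] 0ℚ ℚ.< c × ∃[ N₀ ] (∀ N → N₀ ℕ.≤ N →
    ∃[ k ] HasSize (P ∩ BoundedBy N) k × AtLeastRootMultiple d c N k)

{-# OPTIONS --safe #-}

-- A right triangle with legs l, l′ and hypotenuse h gives three squares
-- (l − l′)², h², (l + l′)² in arithmetic progression with difference 2 l l′.  Two
-- right triangles of equal area thus give two progressions of squares with a common
-- difference d, that is, a cube of dimension 3 contained in the squares, whose
-- steps are d, d and the difference e of the two squared hypotenuses.
--
-- Following Diophantus, p = x² + x y + y² together with either q = x² − y² or
-- r = y (2 x + y) generates triangles of equal area.  Writing x = y + z, the ratio z / y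
-- decides whether d < e (take z = 1) or e < d (take z = y + 1).  The cube is reduced
-- because the squared hypotenuse p² + r² is the sum of its steps d, e and its base,
-- and is coprime to d when the triangle is primitive.  With y linear in a parameter t
-- all entries are O(t⁸), so the bound N admits more than a multiple of N^(1/10) values of t.
module Submission where

open import Defs
open import Algebra.Bundles using (CommutativeRing)
open import Algebra.Definitions.RawSemiring using () renaming (_^_ to pow)
import Algebra.Properties.CommutativeSemiring.Exp as Exp
open import Data.Fin using (Fin; zero; suc; toℕ)
import Data.Fin.Properties as Fin
import Data.Integer as ℤ
import Data.Integer.Properties as ℤ
open import Data.List using (List; length; map; filter; cartesianProduct; upTo)
open import Data.List.Extrema.Nat using (max; xs≤max)
open import Data.List.Membership.Propositional using (_∈_)
open import Data.List.Membership.Propositional.Properties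
  using (∈-cartesianProduct⁺; ∈-filter⁺; ∈-filter⁻; ∈-map⁺; ∈-upTo⁺)
open import Data.List.Membership.Setoid.Properties using (index-injective)
open import Data.List.Relation.Unary.All as All using ()
open import Data.List.Relation.Unary.Any using (index)
open import Data.List.Relation.Unary.Unique.Propositional.Properties
  using (cartesianProduct⁺; filter⁺; upTo⁺)
open import Data.Nat
open import Data.Nat.Coprimality as Coprime using (Coprime; coprime-divisor; coprime-+)
open import Data.Nat.Divisibility
open import Data.Nat.GCD using (gcd; gcd[m,n]∣m; gcd[m,n]∣n)
open import Data.Nat.Properties
open import Data.Nat.Tactic.RingSolver using (solve-∀)
open import Data.Product using (∃-syntax; _×_; _,_; proj₂)
open import Data.Rational as ℚ using (ℚ; 1ℚ)
import Data.Rational.Properties as ℚ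
import Data.Rational.Unnormalised as ℚᵘ
import Data.Rational.Unnormalised.Properties as ℚᵘ
open import Data.Sum using (inj₁; inj₂)
open import Function using (_∘_)
open import Function.Bundles using (mk⇔)
open import Level using (0ℓ)
open import Relation.Binary.Definitions using (tri<; tri≈; tri>)
open import Relation.Binary.PropositionalEquality
open import Relation.Nullary using (contradiction)
open import Relation.Nullary.Decidable using (map′; _×-dec_)
open import Relation.Unary using (Pred; Decidable; _∩_; _⊆_)

-- Counting

module _ {A : Set} where

  -- Pigeonhole: the positions of the `f i` in `xs` form an injection into the indices of `xs`.
  injection⇒≤-length : ∀ {k} {f : Fin k → A} {xs} → (∀ {i j} → f i ≡ f j → i ≡ j) →
                       (∀ i → f i ∈ xs) → k ≤ length xs
  injection⇒≤-length inj f∈xs =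
    Fin.injective⇒≤ {f = index ∘ f∈xs}
      (λ eq → inj (index-injective (setoid A) (f∈xs _) (f∈xs _) eq))

  -- A measure `g` that strictly increases along `f` tells the terms of `f` apart and is unbounded
  -- on them.
  module _ {f : ℕ → A} (g : A → ℕ) (step : ∀ t → g (f t) < g (f (suc t))) where

    measure-mono : ∀ {s t} → s ≤ t → g (f s) ≤ g (f t)
    measure-mono {t = zero}  z≤n = ≤-refl
    measure-mono {t = suc t} s≤1+t with m≤n⇒m<n∨m≡n s≤1+t
    ... | inj₁ (s≤s s≤t) = ≤-trans (measure-mono s≤t) (<⇒≤ (step t))
    ... | inj₂ refl      = ≤-refl

    measure-mono-< : ∀ {s t} → s < t → g (f s) < g (f t)
    measure-mono-< {s} s<t = <-≤-trans (step s) (measure-mono s<t)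

    increasing⇒injective : ∀ {s t} → f s ≡ f t → s ≡ t
    increasing⇒injective {s} {t} eq with <-cmp s t
    ... | tri< s<t _ _ = contradiction (cong g eq) (<⇒≢ (measure-mono-< s<t))
    ... | tri≈ _ s≡t _ = s≡t
    ... | tri> _ _ t<s = contradiction (cong g (sym eq)) (<⇒≢ (measure-mono-< t<s))

    increasing⇒≤ : ∀ t → t ≤ g (f t)
    increasing⇒≤ zero    = z≤n
    increasing⇒≤ (suc t) = ≤-<-trans (increasing⇒≤ t) (step t)

    -- The measure of `f t` is at least `t`, so `t` one past the largest measure in `xs` puts `f t`
    -- outside `xs`.
    increasing⇒infinite : {P : Pred A 0ℓ} → (∀ t → P (f t)) → Infinite P
    increasing⇒infinite Pf xs = f t , Pf t , λ ft∈xs →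
      <-irrefl refl (≤-trans (increasing⇒≤ t)
        (All.lookup (xs≤max 0 (map g xs)) (∈-map⁺ g ft∈xs)))
      where t = suc (max 0 (map g xs))

-- Rational arithmetic for the lower bound

fromℕ-toℚᵘ : ∀ n → ℚ.toℚᵘ (fromℕ n) ℚᵘ.≃ ℚᵘ.mkℚᵘ (ℤ.+ n) 0
fromℕ-toℚᵘ n = ℚ.toℚᵘ-fromℚᵘ (ℚᵘ.mkℚᵘ (ℤ.+ n) 0)

fromℕ-homo-* : ∀ m n → fromℕ (m * n) ≡ fromℕ m ℚ.* fromℕ n
fromℕ-homo-* m n = ℚ.toℚᵘ-injective (begin
  ℚ.toℚᵘ (fromℕ (m * n))                        ≈⟨ fromℕ-toℚᵘ (m * n) ⟩
  ℚᵘ.mkℚᵘ (ℤ.+ (m * n)) 0                       ≡⟨ cong (λ i → ℚᵘ.mkℚᵘ i 0) (ℤ.pos-* m n) ⟩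
  ℚᵘ.mkℚᵘ (ℤ.+ m) 0 ℚᵘ.* ℚᵘ.mkℚᵘ (ℤ.+ n) 0      ≈⟨ ℚᵘ.*-cong (fromℕ-toℚᵘ m) (fromℕ-toℚᵘ n) ⟨
  ℚ.toℚᵘ (fromℕ m) ℚᵘ.* ℚ.toℚᵘ (fromℕ n)        ≈⟨ ℚ.toℚᵘ-homo-* (fromℕ m) (fromℕ n) ⟨
  ℚ.toℚᵘ (fromℕ m ℚ.* fromℕ n)                  ∎)
  where open import Relation.Binary.Reasoning.Setoid ℚᵘ.≃-setoid

fromℕ-mono-≤ : ∀ {m n} → m ≤ n → fromℕ m ℚ.≤ fromℕ n
fromℕ-mono-≤ {m} {n} m≤n = ℚ.toℚᵘ-cancel-≤ (begin
  ℚ.toℚᵘ (fromℕ m)  ≃⟨ fromℕ-toℚᵘ m ⟩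
  ℚᵘ.mkℚᵘ (ℤ.+ m) 0 ≤⟨ ℚᵘ.*≤* (ℤ.*-monoʳ-≤-nonNeg (ℤ.+ 1) (ℤ.+≤+ m≤n)) ⟩
  ℚᵘ.mkℚᵘ (ℤ.+ n) 0 ≃⟨ fromℕ-toℚᵘ n ⟨
  ℚ.toℚᵘ (fromℕ n)  ∎)
  where open ℚᵘ.≤-Reasoning

1/n*n≡1 : ∀ n .{{_ : NonZero n}} → (ℤ.+ 1 ℚ./ n) ℚ.* fromℕ n ≡ 1ℚ
1/n*n≡1 (suc n) = ℚ.toℚᵘ-injective (begin
  ℚ.toℚᵘ ((ℤ.+ 1 ℚ./ suc n) ℚ.* fromℕ (suc n))
    ≈⟨ ℚ.toℚᵘ-homo-* (ℤ.+ 1 ℚ./ suc n) (fromℕ (suc n)) ⟩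
  ℚ.toℚᵘ (ℤ.+ 1 ℚ./ suc n) ℚᵘ.* ℚ.toℚᵘ (fromℕ (suc n))
    ≈⟨ ℚᵘ.*-cong (ℚ.toℚᵘ-fromℚᵘ (ℚᵘ.mkℚᵘ (ℤ.+ 1) n)) (fromℕ-toℚᵘ (suc n)) ⟩
  ℚᵘ.mkℚᵘ (ℤ.+ 1) n ℚᵘ.* ℚᵘ.mkℚᵘ (ℤ.+ suc n) 0
    ≈⟨ ℚᵘ.*≡* (cong ℤ.+_ (identity n)) ⟩
  ℚ.toℚᵘ 1ℚ ∎)
  where
  open import Relation.Binary.Reasoning.Setoid ℚᵘ.≃-setoid
  identity : ∀ n → 1 * suc n * 1 ≡ 1 * (suc n * 1)
  identity = solve-∀

open Exp (CommutativeRing.commutativeSemiring ℚ.+-*-commutativeRing) using (^-distrib-*)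

private
  _^ℚ_ : ℚ → ℕ → ℚ
  _^ℚ_ = pow ℚ.+-*-rawSemiring

fromℕ-homo-^ : ∀ m d → fromℕ (m ^ d) ≡ fromℕ m ^ℚ d
fromℕ-homo-^ m zero    = refl
fromℕ-homo-^ m (suc d) = trans (fromℕ-homo-* m (m ^ d)) (cong (fromℕ m ℚ.*_) (fromℕ-homo-^ m d))

nonNegative-^ : ∀ q .{{_ : ℚ.NonNegative q}} d → ℚ.NonNegative (q ^ℚ d)
nonNegative-^ q zero    = _
nonNegative-^ q (suc d) = ℚ.nonNeg*nonNeg⇒nonNeg q (q ^ℚ d) {{nonNegative-^ q d}}

-- With c = 1/D, multiplying the hypothesis by c^d gives c^d N ≤ (c D k)^d = k^d.
≤^⇒atLeastRootMultiple : ∀ d D .{{_ : NonZero D}} {N k} → N ≤ (D * k) ^ d →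
                         AtLeastRootMultiple d (ℤ.+ 1 ℚ./ D) N k
≤^⇒atLeastRootMultiple d D {N} {k} N≤ = begin
  (c ^ℚ d) ℚ.* fromℕ N                ≤⟨ ℚ.*-monoˡ-≤-nonNeg (c ^ℚ d) (fromℕ-mono-≤ N≤) ⟩
  (c ^ℚ d) ℚ.* fromℕ ((D * k) ^ d)    ≡⟨ cong ((c ^ℚ d) ℚ.*_) (fromℕ-homo-^ (D * k) d) ⟩
  (c ^ℚ d) ℚ.* (fromℕ (D * k) ^ℚ d)   ≡⟨ ^-distrib-* c (fromℕ (D * k)) d ⟨
  (c ℚ.* fromℕ (D * k)) ^ℚ d          ≡⟨ cong (_^ℚ d) cDk≡k ⟩
  fromℕ k ^ℚ d                        ∎
  where
  open ℚ.≤-Reasoning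
  c = ℤ.+ 1 ℚ./ D
  instance
    c^d≥0 : ℚ.NonNegative (c ^ℚ d)
    c^d≥0 = nonNegative-^ c {{ℚ.normalize-nonNeg 1 D}} d
  cDk≡k : c ℚ.* fromℕ (D * k) ≡ fromℕ k
  cDk≡k = begin-equality
    c ℚ.* fromℕ (D * k)           ≡⟨ cong (c ℚ.*_) (fromℕ-homo-* D k) ⟩
    c ℚ.* (fromℕ D ℚ.* fromℕ k)   ≡⟨ ℚ.*-assoc c (fromℕ D) (fromℕ k) ⟨
    c ℚ.* fromℕ D ℚ.* fromℕ k     ≡⟨ cong (ℚ._* fromℕ k) (1/n*n≡1 D) ⟩
    1ℚ ℚ.* fromℕ k                ≡⟨ ℚ.*-identityˡ (fromℕ k) ⟩
    fromℕ k                       ∎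

-- Deciding the predicates and enumerating bounded solutions

square? : Decidable 𝒮
square? x = map′ (λ { (n , _ , eq) → n , eq })
                 (λ { (n , eq) → n , s≤s (≤-trans (n≤n^2 n) (≤-reflexive (sym eq))) , eq })
                 -- A root of `x` is at most `x`, so the search below `suc x` is exhaustive.
                 (anyUpTo? (λ n → x ≟ n ^ 2) (suc x))
  where
  n≤n^2 : ∀ n → n ≤ n ^ 2
  n≤n^2 zero      = z≤n
  n≤n^2 n@(suc _) = m≤m*n n (n ^ 1) {{m^n≢0 n 1}}

-- A cube has at most eight elements, so the inclusion is decided vertex by vertex.
squareCube? : Decidable (λ a → H a ⊆ 𝒮)
squareCube? a =
  map′ (λ all → λ { (i , j , k , refl) → all i j k }) (λ H⊆𝒮 i j k → H⊆𝒮 (i , j , k , refl))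
       (Fin.all? λ i → Fin.all? λ j → Fin.all? λ k → square? _)

reducedSquareCube? : Decidable ReducedSquareCube
reducedSquareCube? a@(a₀ , a₁ , a₂ , a₃) =
  (1 ≤? a₁ ×-dec 1 ≤? a₂ ×-dec 1 ≤? a₃) ×-dec
  (gcd a₀ (gcd a₁ (gcd a₂ a₃)) ≟ 1) ×-dec squareCube? a

firstTwoEqual? : Decidable FirstTwoEqual
firstTwoEqual? (_ , a₁ , a₂ , a₃) = a₁ ≟ a₂ ×-dec a₂ <? a₃

lastTwoEqual? : Decidable LastTwoEqual
lastTwoEqual? (_ , a₁ , a₂ , a₃) = a₁ <? a₂ ×-dec a₂ ≟ a₃

boundedBy? : ∀ N → Decidable (BoundedBy N)
boundedBy? N (a₀ , a₁ , a₂ , a₃) = a₀ ≤? N ×-dec a₁ ≤? N ×-dec a₂ ≤? N ×-dec a₃ ≤? N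

boundedBy-mono : ∀ {M N} → M ≤ N → BoundedBy M ⊆ BoundedBy N
boundedBy-mono M≤N (b₀ , b₁ , b₂ , b₃) =
  ≤-trans b₀ M≤N , ≤-trans b₁ M≤N , ≤-trans b₂ M≤N , ≤-trans b₃ M≤N

module _ {P : Pred Tuple 0ℓ} (P? : Decidable P) where

  private
    bounded? : ∀ N → Decidable (P ∩ BoundedBy N)
    bounded? N a = P? a ×-dec boundedBy? N a

    box : ℕ → List Tuple
    box N = cartesianProduct r (cartesianProduct r (cartesianProduct r r))
      where r = upTo (suc N)

  boundedSolutions : ℕ → List Tuple
  boundedSolutions N = filter (bounded? N) (box N)

  ∈-boundedSolutions⁺ : ∀ {N a} → (P ∩ BoundedBy N) a → a ∈ boundedSolutions N
  ∈-boundedSolutions⁺ {N} PB@(_ , b₀ , b₁ , b₂ , b₃) =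
    ∈-filter⁺ (bounded? N)
      (∈-cartesianProduct⁺ (∈-upTo⁺ (s≤s b₀)) (∈-cartesianProduct⁺ (∈-upTo⁺ (s≤s b₁))
        (∈-cartesianProduct⁺ (∈-upTo⁺ (s≤s b₂)) (∈-upTo⁺ (s≤s b₃)))))
      PB

  boundedSolutions-size : ∀ N → HasSize (P ∩ BoundedBy N) (length (boundedSolutions N))
  boundedSolutions-size N =
    boundedSolutions N ,
    filter⁺ (bounded? N) (cartesianProduct⁺ u (cartesianProduct⁺ u (cartesianProduct⁺ u u))) ,
    (λ a → mk⇔ (λ a∈ → proj₂ (∈-filter⁻ (bounded? N) {xs = box N} a∈)) ∈-boundedSolutions⁺) ,
    refl
    where u = upTo⁺ (suc N)

-- Downward search: N < F (N + 1) holds at the start, and the search stops at the first k with F k ≤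
-- N, at the latest at k = 0.
inverse : ∀ (F : ℕ → ℕ) → (∀ k → k < F k) → ∀ N → F 0 ≤ N → ∃[ k ] F k ≤ N × N < F (suc k)
inverse F k<Fk N F0≤N = go N (<-trans (n<1+n N) (k<Fk (suc N)))
  where
  go : ∀ k → N < F (suc k) → ∃[ k ] F k ≤ N × N < F (suc k)
  go zero    N<F = zero , F0≤N , N<F
  go (suc k) N<F with ≤-<-connex (F (suc k)) N
  ... | inj₁ F≤N = suc k , F≤N , N<F
  ... | inj₂ N<F′ = go k N<F′

-- Let F k = (C (k + 1))^d. If F k ≤ N < F (k + 1), then f 0, ..., f k are k + 1 distinct solutions
-- within N, while N < (C (k + 2))^d ≤ (2 C (k + 1))^d. Hence the constant 1/(2 C).
family⇒countAtLeastRoot : ∀ d .{{_ : NonZero d}} C .{{_ : NonZero C}} {P} → Decidable P →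
  ∀ {f} (g : Tuple → ℕ) → (∀ t → g (f t) < g (f (suc t))) → (∀ t → P (f t)) →
  (∀ t → BoundedBy ((C * suc t) ^ d) (f t)) → CountAtLeastRoot d P
family⇒countAtLeastRoot d C {P} P? {f} g step Pf bound =
  ℤ.+ 1 ℚ./ (2 * C) ,
  ℚ.positive⁻¹ _ {{ℚ.normalize-pos 1 (2 * C)}} ,
  F 0 , λ N F0≤N →
    length (boundedSolutions P? N) , boundedSolutions-size P? N ,
    ≤^⇒atLeastRootMultiple d (2 * C) (lowerBound N (inverse F k<Fk N F0≤N))
  where
  instance
    2C≢0 : NonZero (2 * C)
    2C≢0 = m*n≢0 2 C

  F : ℕ → ℕ
  F k = (C * suc k) ^ d

  k<Fk : ∀ k → k < F k
  k<Fk k = begin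
    suc k            ≤⟨ m≤n*m (suc k) C ⟩
    C * suc k        ≡⟨ ^-identityʳ (C * suc k) ⟨
    (C * suc k) ^ 1  ≤⟨ ^-monoʳ-≤ (C * suc k) {{m*n≢0 C (suc k)}} (>-nonZero⁻¹ d) ⟩
    F k              ∎
    where open ≤-Reasoning

  lowerBound : ∀ N → ∃[ k ] F k ≤ N × N < F (suc k) →
               N ≤ (2 * C * length (boundedSolutions P? N)) ^ d
  lowerBound N (k , Fk≤N , N<F) = begin
    N                                             ≤⟨ <⇒≤ N<F ⟩
    (C * suc (suc k)) ^ d                         ≤⟨ ^-monoˡ-≤ d (*-monoʳ-≤ C 2+k≤2[1+k]) ⟩
    (C * (2 * suc k)) ^ d                         ≡⟨ cong (_^ d) (rearrange C (suc k)) ⟩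
    (2 * C * suc k) ^ d                           ≤⟨ ^-monoˡ-≤ d (*-monoʳ-≤ (2 * C) 1+k≤length) ⟩
    (2 * C * length (boundedSolutions P? N)) ^ d  ∎
    where
    open ≤-Reasoning
    2+k≤2[1+k] : suc (suc k) ≤ 2 * suc k
    2+k≤2[1+k] = +-mono-≤ {1} (s≤s z≤n) (≤-reflexive (sym (+-identityʳ (suc k))))
    rearrange : ∀ C k → C * (2 * k) ≡ 2 * C * k
    rearrange = solve-∀
    1+k≤length : suc k ≤ length (boundedSolutions P? N)
    1+k≤length = injection⇒≤-length {f = f ∘ toℕ}
      (λ eq → Fin.toℕ-injective (increasing⇒injective g step eq))
      (λ i → ∈-boundedSolutions⁺ P? (Pf (toℕ i) ,
        boundedBy-mono (≤-trans (^-monoˡ-≤ d (*-monoʳ-≤ C (Fin.toℕ<n i))) Fk≤N) (bound (toℕ i))))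

-- Triangles and progressions of squares

∣m+n∣n⇒∣m : ∀ {i m n} → i ∣ m + n → i ∣ n → i ∣ m
∣m+n∣n⇒∣m {i} {m} {n} i∣m+n = ∣m+n∣m⇒∣n (subst (i ∣_) (+-comm m n) i∣m+n)

coprime-*ʳ : ∀ {k m n} → Coprime k m → Coprime k n → Coprime k (m * n)
coprime-*ʳ k⊥m k⊥n (i∣k , i∣mn) =
  k⊥n (i∣k , coprime-divisor (λ (j∣i , j∣m) → k⊥m (∣-trans j∣i i∣k , j∣m)) i∣mn)

coprime-*ˡ : ∀ {k m n} → Coprime m k → Coprime n k → Coprime (m * n) k
coprime-*ˡ m⊥k n⊥k = Coprime.sym (coprime-*ʳ (Coprime.sym m⊥k) (Coprime.sym n⊥k))

square : ∀ n → 𝒮 (n * n)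
square n = n , cong (n *_) (sym (*-identityʳ n))

-- Either leg of a triangle may be the longer one, so both orders are treated.
∣m-n∣²+2mn≡m²+n² : ∀ m n → ∣ m - n ∣ * ∣ m - n ∣ + 2 * (m * n) ≡ m * m + n * n
∣m-n∣²+2mn≡m²+n² m n with ≤-total m n
... | inj₁ m≤n with k , refl ← m≤n⇒∃[o]m+o≡n m≤n rewrite ∣m-m+n∣≡n m k = identity m k
  where
  identity : ∀ m k → k * k + 2 * (m * (m + k)) ≡ m * m + (m + k) * (m + k)
  identity = solve-∀
... | inj₂ n≤m with k , refl ← m≤n⇒∃[o]m+o≡n n≤m
  rewrite ∣-∣-comm (n + k) n | ∣m-m+n∣≡n n k = identity n k
  where
  identity : ∀ n k → k * k + 2 * ((n + k) * n) ≡ (n + k) * (n + k) + n * n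
  identity = solve-∀

SquareProgression : ℕ → ℕ → Set
SquareProgression a d = 𝒮 a × 𝒮 (a + d) × 𝒮 (a + 2 * d)

-- `k` selects one of the two progressions, and `i + j` is the number of steps taken along it.
progressions⇒cube : ∀ {a d e} → SquareProgression a d → SquareProgression (a + e) d →
  ∀ (i j k : Fin 2) → 𝒮 (a + toℕ i * d + toℕ j * d + toℕ k * e)
progressions⇒cube {a} {d} {e} P Q i j k =
  subst 𝒮 (rearrange a d e (toℕ i) (toℕ j) (toℕ k)) (level i j (base k))
  where
  rearrange : ∀ a d e i j k → a + k * e + (i + j) * d ≡ a + i * d + j * d + k * e
  rearrange = solve-∀

  base : ∀ k → SquareProgression (a + toℕ k * e) d
  base zero       = subst (λ b → SquareProgression b d) (sym (+-identityʳ a)) P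
  base (suc zero) = subst (λ b → SquareProgression (a + b) d) (sym (+-identityʳ e)) Q

  level : ∀ i j {b} → SquareProgression b d → 𝒮 (b + (toℕ i + toℕ j) * d)
  level zero       zero       {b} (s , _ , _) = subst 𝒮 (sym (+-identityʳ b)) s
  level zero       (suc zero) {b} (_ , s , _) = subst (λ c → 𝒮 (b + c)) (sym (+-identityʳ d)) s
  level (suc zero) zero       {b} (_ , s , _) = subst (λ c → 𝒮 (b + c)) (sym (+-identityʳ d)) s
  level (suc zero) (suc zero) (_ , _ , s) = s

-- The right triangle generated by p = q + v and q.  Its squared hypotenuse is
-- the middle term of a progression of squares whose common difference is four
-- times its area.
module _ (v q : ℕ) where

  leg₁ leg₂ hypotenuse difference legGap : ℕ
  leg₁       = 2 * ((q + v) * q)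
  leg₂       = v * (q + v + q)
  hypotenuse = (q + v) * (q + v) + q * q
  difference = 2 * (leg₁ * leg₂)
  legGap     = ∣ leg₁ - leg₂ ∣

  -- This is (2 p q)² + (p² - q²)² = (p² + q²)², where `leg₂` is p² - q² factored as (p - q)(p + q).
  pythagoras : leg₁ * leg₁ + leg₂ * leg₂ ≡ hypotenuse * hypotenuse
  pythagoras = identity v q
    where
    identity : ∀ v q →
      2 * ((q + v) * q) * (2 * ((q + v) * q)) + v * (q + v + q) * (v * (q + v + q)) ≡
      ((q + v) * (q + v) + q * q) * ((q + v) * (q + v) + q * q)
    identity = solve-∀

  gap²+difference : legGap * legGap + difference ≡ hypotenuse * hypotenuse
  gap²+difference = trans (∣m-n∣²+2mn≡m²+n² leg₁ leg₂) pythagoras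

  triangle-progression : SquareProgression (legGap * legGap) difference
  triangle-progression =
    square legGap ,
    subst 𝒮 (sym gap²+difference) (square hypotenuse) ,
    subst 𝒮 (sym top) (square (leg₁ + leg₂))
    where
    open ≡-Reasoning
    double : ∀ a d → a + 2 * d ≡ a + d + d
    double = solve-∀
    binomial : ∀ a b → a * a + b * b + 2 * (a * b) ≡ (a + b) * (a + b)
    binomial = solve-∀
    top : legGap * legGap + 2 * difference ≡ (leg₁ + leg₂) * (leg₁ + leg₂)
    top = begin
      legGap * legGap + 2 * difference             ≡⟨ double (legGap * legGap) difference ⟩
      legGap * legGap + difference + difference    ≡⟨ cong (_+ difference) gap²+difference ⟩
      hypotenuse * hypotenuse + difference         ≡⟨ cong (_+ difference) pythagoras ⟨
      leg₁ * leg₁ + leg₂ * leg₂ + difference       ≡⟨ binomial leg₁ leg₂ ⟩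
      (leg₁ + leg₂) * (leg₁ + leg₂)                ∎

  -- The difference is built from the factors 2, p, q, v and p + q. The hypotenuse p² + q² is
  -- coprime to p and q because these are coprime, and to 2 because q is even. It equals v² + 2 p q
  -- and also (p + q)² - 2 p q, so a divisor shared with v or p + q would divide `leg₁`.
  hypotenuse²⊥difference : Coprime v q → 2 ∣ q → Coprime (hypotenuse * hypotenuse) difference
  hypotenuse²⊥difference v⊥q 2∣q = coprime-*ˡ h⊥d h⊥d
    where
    p = q + v
    identity₁ : ∀ v q → (q + v) * (q + v) + q * q ≡ v * v + 2 * ((q + v) * q)
    identity₁ = solve-∀
    identity₂ : ∀ v q → (q + v) * (q + v) + q * q + 2 * ((q + v) * q) ≡ (q + v + q) * (q + v + q)
    identity₂ = solve-∀
    p⊥q : Coprime p q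
    p⊥q = coprime-+ v⊥q
    h⊥q : Coprime hypotenuse q
    h⊥q (i∣h , i∣q) = coprime-*ˡ p⊥q p⊥q (∣m+n∣n⇒∣m i∣h (∣m⇒∣m*n q i∣q) , i∣q)
    h⊥p : Coprime hypotenuse p
    h⊥p (i∣h , i∣p) = coprime-*ʳ p⊥q p⊥q (i∣p , ∣m+n∣m⇒∣n i∣h (∣m⇒∣m*n p i∣p))
    h⊥2 : Coprime hypotenuse 2
    h⊥2 (i∣h , i∣2) = h⊥q (i∣h , ∣-trans i∣2 2∣q)
    h⊥leg₁ : Coprime hypotenuse leg₁
    h⊥leg₁ = coprime-*ʳ h⊥2 (coprime-*ʳ h⊥p h⊥q)
    h⊥v : Coprime hypotenuse v
    h⊥v {i} (i∣h , i∣v) =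
      h⊥leg₁ (i∣h , ∣m+n∣m⇒∣n (subst (i ∣_) (identity₁ v q) i∣h) (∣m⇒∣m*n v i∣v))
    h⊥p+q : Coprime hypotenuse (p + q)
    h⊥p+q {i} (i∣h , i∣p+q) =
      h⊥leg₁ (i∣h , ∣m+n∣m⇒∣n (subst (i ∣_) (sym (identity₂ v q)) (∣m⇒∣m*n (p + q) i∣p+q)) i∣h)
    h⊥d : Coprime hypotenuse difference
    h⊥d = coprime-*ʳ h⊥2 (coprime-*ʳ h⊥leg₁ (coprime-*ʳ h⊥v h⊥p+q))

-- The factor 4 p is split off because two triangles with the same p share it; what remains is q (p²
-- - q²).
difference≡ : ∀ v q → difference v q ≡ 4 * (q + v) * (q * (v * (q + v + q)))
difference≡ = identity
  where
  identity : ∀ v q → 2 * (2 * ((q + v) * q) * (v * (q + v + q))) ≡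
                     4 * (q + v) * (q * (v * (q + v + q)))
  identity = solve-∀

-- Here x = y + z, v = p − q and w = p − r.
module EqualAreas (y z : ℕ) where

  q r v w p s base diff gap : ℕ
  q = z * (2 * y + z)
  r = y * (3 * y + 2 * z)
  v = y * (3 * y + z)
  w = z * (y + z)
  p = q + v
  s = r ∸ q
  base = legGap v q * legGap v q
  diff = difference v q
  gap  = s * (q + r) * (2 * (p * p) + q * q + r * r)

  p≡r+w : p ≡ r + w
  p≡r+w = identity y z
    where
    identity : ∀ y z → z * (2 * y + z) + y * (3 * y + z) ≡ y * (3 * y + 2 * z) + z * (y + z)
    identity = solve-∀

  -- The claim amounts to q (p² - q²) = r (p² - r²), that is, r³ - q³ = p² (r - q). It holds because
  -- this parametrisation satisfies p² = q² + q r + r².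
  diff≡ : diff ≡ difference w r
  diff≡ = begin
    diff                              ≡⟨ difference≡ v q ⟩
    4 * p * (q * (v * (p + q)))       ≡⟨ cong (4 * p *_) (areas y z) ⟩
    4 * p * (r * (w * (r + w + r)))   ≡⟨ cong (λ p → 4 * p * (r * (w * (r + w + r)))) p≡r+w ⟩
    4 * (r + w) * (r * (w * (r + w + r)))
                                      ≡⟨ difference≡ w r ⟨
    difference w r                    ∎
    where
    open ≡-Reasoning
    areas : ∀ y z →
      z * (2 * y + z) * (y * (3 * y + z) * (z * (2 * y + z) + y * (3 * y + z) + z * (2 * y + z))) ≡
      y * (3 * y + 2 * z) * (z * (y + z) * (y * (3 * y + 2 * z) + z * (y + z) + y * (3 * y + 2 * z)))
    areas = solve-∀

  module _ (q≤r : q ≤ r) where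

    -- Two differences of squares: (p² + r²)² - (p² + q²)² = (r² - q²)(2 p² + q² + r²) and r² - q² =
    -- (r - q)(r + q). Since q ≤ r, the truncated `s` is the true r - q.
    hypotenuse²-gap : hypotenuse v q * hypotenuse v q + gap ≡ hypotenuse w r * hypotenuse w r
    hypotenuse²-gap = begin
      hypotenuse v q * hypotenuse v q + gap
        ≡⟨ cong (λ r → hypotenuse v q * hypotenuse v q
                         + s * (q + r) * (2 * (p * p) + q * q + r * r)) q+s≡r ⟨
      (p * p + q * q) * (p * p + q * q)
        + s * (q + (q + s)) * (2 * (p * p) + q * q + (q + s) * (q + s))
        ≡⟨ identity p q s ⟩
      (p * p + (q + s) * (q + s)) * (p * p + (q + s) * (q + s))
        ≡⟨ cong₂ (λ p r → (p * p + r * r) * (p * p + r * r)) p≡r+w q+s≡r ⟩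
      hypotenuse w r * hypotenuse w r ∎
      where
      open ≡-Reasoning
      q+s≡r : q + s ≡ r
      q+s≡r = m+[n∸m]≡n q≤r
      identity : ∀ p q s →
        (p * p + q * q) * (p * p + q * q)
          + s * (q + (q + s)) * (2 * (p * p) + q * q + (q + s) * (q + s)) ≡
        (p * p + (q + s) * (q + s)) * (p * p + (q + s) * (q + s))
      identity = solve-∀

    -- This vertex both bounds all entries of the cube and carries the coprimality argument.
    total : base + diff + gap ≡ hypotenuse w r * hypotenuse w r
    total = trans (cong (_+ gap) (gap²+difference v q)) hypotenuse²-gap

    -- Both sides become the second squared hypotenuse once the common difference is added.
    base+gap : base + gap ≡ legGap w r * legGap w r
    base+gap = +-cancelʳ-≡ diff _ _ (begin
      base + gap + diff                        ≡⟨ swap base gap diff ⟩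
      base + diff + gap                        ≡⟨ total ⟩
      hypotenuse w r * hypotenuse w r          ≡⟨ gap²+difference w r ⟨
      legGap w r * legGap w r + difference w r ≡⟨ cong (legGap w r * legGap w r +_) diff≡ ⟨
      legGap w r * legGap w r + diff           ∎)
      where
      open ≡-Reasoning
      swap : ∀ a b c → a + b + c ≡ a + c + b
      swap = solve-∀

    cubeSquares : ∀ (i j k : Fin 2) → 𝒮 (base + toℕ i * diff + toℕ j * diff + toℕ k * gap)
    cubeSquares = progressions⇒cube (triangle-progression v q)
      (subst₂ SquareProgression (sym base+gap) (sym diff≡) (triangle-progression w r))

    -- A common divisor divides both the second squared hypotenuse and its difference, which are
    -- coprime if w ⊥ r and r is even. With w = z (y + z) and r = y (3 y + 2 z), modulo z the factor
    -- 3 y + 2 z is 3 y, whence the condition on 3; modulo y + z it is y.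
    commonDivisor≡1 : Coprime z y → Coprime z 3 → 2 ∣ y →
                      ∀ {i} → i ∣ base → i ∣ diff → i ∣ gap → i ≡ 1
    commonDivisor≡1 z⊥y z⊥3 2∣y {i} i∣base i∣diff i∣gap =
      hypotenuse²⊥difference w r w⊥r (∣m⇒∣m*n _ 2∣y)
        ( subst (i ∣_) total (∣m∣n⇒∣m+n (∣m∣n⇒∣m+n i∣base i∣diff) i∣gap)
        , subst (i ∣_) diff≡ i∣diff )
      where
      z⊥3y+2z : Coprime z (3 * y + 2 * z)
      z⊥3y+2z {j} (j∣z , j∣) =
        coprime-*ʳ z⊥3 z⊥y (j∣z , ∣m+n∣n⇒∣m j∣ (∣n⇒∣m*n 2 j∣z))
      y+z⊥y : Coprime (y + z) y
      y+z⊥y = coprime-+ z⊥y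
      y+z⊥3y+2z : Coprime (y + z) (3 * y + 2 * z)
      y+z⊥3y+2z {j} (j∣y+z , j∣) =
        y+z⊥y (j∣y+z , ∣m+n∣m⇒∣n (subst (j ∣_) (split y z) j∣) (∣n⇒∣m*n 2 j∣y+z))
        where
        split : ∀ y z → 3 * y + 2 * z ≡ 2 * (y + z) + y
        split = solve-∀
      w⊥r : Coprime w r
      w⊥r = coprime-*ˡ (coprime-*ʳ z⊥y z⊥3y+2z) (coprime-*ʳ y+z⊥y y+z⊥3y+2z)

  -- As v and q are at most p, `diff` is at most 8 q p³ < 8 q r · 2 p², and the factors of `gap`
  -- dominate 8 q, r and 2 p².
  diff<gap : 0 < q → 8 * q ≤ s → p < 2 * r → diff < gap
  diff<gap 0<q 8q≤s p<2r = begin-strict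
    diff                               ≡⟨ difference≡ v q ⟩
    4 * p * (q * (v * (p + q)))
      ≤⟨ *-monoʳ-≤ (4 * p) (*-monoʳ-≤ q (*-mono-≤ (m≤n+m v q) (+-monoʳ-≤ p (m≤m+n q v)))) ⟩
    4 * p * (q * (p * (p + p)))        ≡⟨ regroup₁ p q ⟩
    8 * q * (p * p * p)
      <⟨ *-monoʳ-< (8 * q) {{>-nonZero 0<8q}}
           (*-monoʳ-< (p * p) {{>-nonZero (*-mono-< 0<p 0<p)}} p<2r) ⟩
    8 * q * (p * p * (2 * r))          ≡⟨ regroup₂ p q r ⟩
    8 * q * r * (2 * (p * p))
      ≤⟨ *-mono-≤ (*-mono-≤ 8q≤s (m≤n+m r q)) (≤-trans (m≤m+n _ (q * q)) (m≤m+n _ (r * r))) ⟩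
    gap                                ∎
    where
    open ≤-Reasoning
    0<p : 0 < p
    0<p = ≤-trans 0<q (m≤m+n q v)
    0<8q : 0 < 8 * q
    0<8q = *-monoʳ-< 8 0<q
    regroup₁ : ∀ p q → 4 * p * (q * (p * (p + p))) ≡ 8 * q * (p * p * p)
    regroup₁ = solve-∀
    regroup₂ : ∀ p q r → 8 * q * (p * p * (2 * r)) ≡ 8 * q * r * (2 * (p * p))
    regroup₂ = solve-∀

  -- Compare 2 `gap` with 2 `diff` = v (q + p) · 8 p q: the factor 2 s (q + r) is at most v (q + p),
  -- and the remaining factor stays below 8 p q.
  gap<diff : 0 < q → 0 < v → 2 * s ≤ v → r ≤ 2 * q → 2 * p < 5 * q → gap < diff
  gap<diff 0<q 0<v 2s≤v r≤2q 2p<5q = *-cancelˡ-< 2 gap diff (begin-strict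
    2 * gap
      ≡⟨ regroup₁ s (q + r) (2 * (p * p) + q * q + r * r) ⟩
    2 * s * (q + r) * (2 * (p * p) + q * q + r * r)
      ≤⟨ *-monoˡ-≤ (2 * (p * p) + q * q + r * r) (*-mono-≤ 2s≤v (+-monoʳ-≤ q r≤p)) ⟩
    v * (q + p) * (2 * (p * p) + q * q + r * r)
      <⟨ *-monoʳ-< (v * (q + p)) {{>-nonZero (*-mono-< 0<v (≤-trans 0<q (m≤m+n q p)))}} squares<8pq ⟩
    v * (q + p) * (8 * (p * q))                   ≡⟨ regroup₂ v p q ⟩
    2 * (4 * p * (q * (v * (p + q))))             ≡⟨ cong (2 *_) (difference≡ v q) ⟨
    2 * diff                                      ∎)
    where
    open ≤-Reasoning
    r≤p : r ≤ p
    r≤p = ≤-trans (m≤m+n r w) (≤-reflexive (sym p≡r+w))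
    0<p : 0 < p
    0<p = ≤-trans 0<q (m≤m+n q v)
    regroup₁ : ∀ s t m → 2 * (s * t * m) ≡ 2 * s * t * m
    regroup₁ = solve-∀
    regroup₂ : ∀ v p q → v * (q + p) * (8 * (p * q)) ≡ 2 * (4 * p * (q * (v * (p + q))))
    regroup₂ = solve-∀
    collect₁ : ∀ p → 2 * (p * p) ≡ p * (2 * p)
    collect₁ = solve-∀
    collect₂ : ∀ p q → p * (5 * q) + p * q + p * (2 * q) ≡ 8 * (p * q)
    collect₂ = solve-∀
    -- The three terms are bounded by 5 p q, p q and 2 p q, the first strictly.
    squares<8pq : 2 * (p * p) + q * q + r * r < 8 * (p * q)
    squares<8pq = begin-strict
      2 * (p * p) + q * q + r * r            ≡⟨ cong (λ x → x + q * q + r * r) (collect₁ p) ⟩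
      p * (2 * p) + q * q + r * r
        <⟨ +-mono-<-≤
             (+-mono-<-≤ (*-monoʳ-< p {{>-nonZero 0<p}} 2p<5q) (*-monoˡ-≤ q (m≤m+n q v)))
             (*-mono-≤ r≤p r≤2q) ⟩
      p * (5 * q) + p * q + p * (2 * q)      ≡⟨ collect₂ p q ⟩
      8 * (p * q)                            ∎

  -- At z = y + 1 the value of p is 7 y² + 5 y + 1, which lies below 9 (y + 1)².
  p≤[3+3y]² : z ≤ suc y → p ≤ 3 * suc y * (3 * suc y)
  p≤[3+3y]² z≤1+y = begin
    p
      ≤⟨ +-mono-≤ (*-mono-≤ z≤1+y (+-monoʳ-≤ (2 * y) z≤1+y))
                  (*-monoʳ-≤ y (+-monoʳ-≤ (3 * y) z≤1+y)) ⟩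
    suc y * (2 * y + suc y) + y * (3 * y + suc y)
      ≤⟨ m≤m+n _ _ ⟩
    suc y * (2 * y + suc y) + y * (3 * y + suc y) + (2 * (y * y) + 13 * y + 8)
      ≡⟨ identity y ⟩
    3 * suc y * (3 * suc y) ∎
    where
    open ≤-Reasoning
    identity : ∀ y → suc y * (2 * y + suc y) + y * (3 * y + suc y) + (2 * (y * y) + 13 * y + 8) ≡
                     3 * suc y * (3 * suc y)
    identity = solve-∀

  -- The hypotenuse p² + r² is at most 2 x⁴; spending one more power of x on the factor 2 gives x⁵,
  -- hence the exponent 10 after squaring.
  hypotenuse²≤ : ∀ {x} → 2 ≤ x → p ≤ x * x → hypotenuse w r * hypotenuse w r ≤ x ^ 10
  hypotenuse²≤ {x} 2≤x p≤x² = begin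
    hypotenuse w r * hypotenuse w r ≤⟨ *-mono-≤ h≤x⁵ h≤x⁵ ⟩
    x ^ 5 * x ^ 5                   ≡⟨ ^-distribˡ-+-* x 5 5 ⟨
    x ^ 10                          ∎
    where
    open ≤-Reasoning
    r+w≤x² : r + w ≤ x * x
    r+w≤x² = ≤-trans (≤-reflexive (sym p≡r+w)) p≤x²
    r≤x² : r ≤ x * x
    r≤x² = ≤-trans (m≤m+n r w) r+w≤x²
    collect : ∀ x → x * x * (x * x) + x * x * (x * x) ≡ 2 * (x * (x * (x * (x * 1))))
    collect = solve-∀
    h≤x⁵ : hypotenuse w r ≤ x ^ 5
    h≤x⁵ = begin
      hypotenuse w r                          ≤⟨ +-mono-≤ (*-mono-≤ r+w≤x² r+w≤x²) (*-mono-≤ r≤x² r≤x²) ⟩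
      x * x * (x * x) + x * x * (x * x)       ≡⟨ collect x ⟩
      2 * x ^ 4                               ≤⟨ *-monoˡ-≤ (x ^ 4) 2≤x ⟩
      x ^ 5                                   ∎

*-mono-≤-< : ∀ {m n o p} → m ≤ n → o < p → 0 < n → m * o < n * p
*-mono-≤-< {n = n} {o} m≤n o<p 0<n = ≤-<-trans (*-monoˡ-≤ o m≤n) (*-monoʳ-< n {{>-nonZero 0<n}} o<p)

open EqualAreas

diff-mono-< : ∀ {y y′ z z′} → y < y′ → z ≤ z′ → 0 < z′ → diff y z < diff y′ z′
diff-mono-< {y} {y′} {z} {z′} y<y′ z≤z′ 0<z′ =
  *-monoʳ-< 2 (*-mono-< (*-monoʳ-< 2 (*-mono-< p<p′ q<q′)) (*-mono-< v<v′ (+-mono-< p<p′ q<q′)))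
  where
  q<q′ : q y z < q y′ z′
  q<q′ = *-mono-≤-< z≤z′ (+-mono-<-≤ (*-monoʳ-< 2 y<y′) z≤z′) 0<z′
  v<v′ : v y z < v y′ z′
  v<v′ = *-mono-< y<y′ (+-mono-<-≤ (*-monoʳ-< 3 y<y′) z≤z′)
  p<p′ : p y z < p y′ z′
  p<p′ = +-mono-< q<q′ v<v′

-- One-parameter families of cubes

commonDivisors≡1⇒reduced : ∀ {a₀ a₁ a₂ a₃} → (∀ {i} → i ∣ a₀ → i ∣ a₁ → i ∣ a₂ → i ∣ a₃ → i ≡ 1) →
                           Reduced (a₀ , a₁ , a₂ , a₃)
commonDivisors≡1⇒reduced {a₀} {a₁} {a₂} {a₃} h =
  h (gcd[m,n]∣m a₀ _)
    (∣-trans (gcd[m,n]∣n a₀ _) (gcd[m,n]∣m a₁ _))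
    (∣-trans (gcd[m,n]∣n a₀ _) (∣-trans (gcd[m,n]∣n a₁ _) (gcd[m,n]∣m a₂ a₃)))
    (∣-trans (gcd[m,n]∣n a₀ _) (∣-trans (gcd[m,n]∣n a₁ _) (gcd[m,n]∣n a₂ a₃)))

-- These are the conditions common to both choices of z; which of the two steps is larger is left to
-- the last two lemmas of the module.
module Family
  (y z : ℕ → ℕ)
  (y-increasing : ∀ t → y t < y (suc t))
  (z-monotone : ∀ t → z t ≤ z (suc t))
  (0<y : ∀ t → 0 < y t)
  (0<z : ∀ t → 0 < z t)
  (z≤1+y : ∀ t → z t ≤ suc (y t))
  (C : ℕ) (2≤C : 2 ≤ C) (3[1+y]≤C[1+t] : ∀ t → 3 * suc (y t) ≤ C * suc t)
  (z⊥y : ∀ t → Coprime (z t) (y t))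
  (z⊥3 : ∀ t → Coprime (z t) 3)
  (2∣y : ∀ t → 2 ∣ y t)
  (q≤r : ∀ t → q (y t) (z t) ≤ r (y t) (z t))
  where

  a b c : ℕ → ℕ
  a t = base (y t) (z t)
  b t = diff (y t) (z t)
  c t = gap (y t) (z t)

  b-increasing : ∀ t → b t < b (suc t)
  b-increasing t = diff-mono-< (y-increasing t) (z-monotone t) (0<z (suc t))

  0<b : ∀ t → 0 < b t
  -- Positivity follows by comparison with the value at y = 0.
  0<b t = ≤-<-trans z≤n (diff-mono-< (0<y t) ≤-refl (0<z t))

  instance
    C≢0 : NonZero C
    C≢0 = >-nonZero (<⇒≤ 2≤C)

  total≤ : ∀ t → a t + b t + c t ≤ (C * suc t) ^ 10
  total≤ t = ≤-trans (≤-reflexive (total (y t) (z t) (q≤r t)))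
    (hypotenuse²≤ (y t) (z t) (≤-trans 2≤C (m≤m*n C (suc t)))
      (≤-trans (p≤[3+3y]² (y t) (z t) (z≤1+y t)) (*-mono-≤ (3[1+y]≤C[1+t] t) (3[1+y]≤C[1+t] t))))

  a≤ : ∀ t → a t ≤ (C * suc t) ^ 10
  a≤ t = ≤-trans (≤-trans (m≤m+n (a t) (b t)) (m≤m+n _ (c t))) (total≤ t)

  b≤ : ∀ t → b t ≤ (C * suc t) ^ 10
  b≤ t = ≤-trans (≤-trans (m≤n+m (b t) (a t)) (m≤m+n _ (c t))) (total≤ t)

  c≤ : ∀ t → c t ≤ (C * suc t) ^ 10
  c≤ t = ≤-trans (m≤n+m (c t) _) (total≤ t)

  commonDivisor≡1′ : ∀ t {i} → i ∣ a t → i ∣ b t → i ∣ c t → i ≡ 1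
  commonDivisor≡1′ t = commonDivisor≡1 (y t) (z t) (q≤r t) (z⊥y t) (z⊥3 t) (2∣y t)

  firstTwoEqual-family : (∀ t → b t < c t) →
    Infinite (ReducedSquareCube ∩ FirstTwoEqual)
      × CountAtLeastRoot 10 (ReducedSquareCube ∩ FirstTwoEqual)
  firstTwoEqual-family b<c =
    increasing⇒infinite {f = f} a₁ b-increasing f∈ ,
    family⇒countAtLeastRoot 10 C (λ a → reducedSquareCube? a ×-dec firstTwoEqual? a)
      {f = f} a₁ b-increasing f∈
      (λ t → a≤ t , b≤ t , b≤ t , c≤ t)
    where
    f : ℕ → Tuple
    f t = a t , b t , b t , c t
    a₁ : Tuple → ℕ
    a₁ (_ , a₁ , _) = a₁
    f∈ : ∀ t → (ReducedSquareCube ∩ FirstTwoEqual) (f t)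
    f∈ t =
      ( (0<b t , 0<b t , <-trans (0<b t) (b<c t))
      , commonDivisors≡1⇒reduced {a t} {b t} {b t} {c t}
          (λ i∣a i∣b _ i∣c → commonDivisor≡1′ t i∣a i∣b i∣c)
      , λ { (i , j , k , refl) → cubeSquares (y t) (z t) (q≤r t) i j k }) ,
      refl , b<c t

  lastTwoEqual-family : (∀ t → 0 < c t) → (∀ t → c t < b t) →
    Infinite (ReducedSquareCube ∩ LastTwoEqual)
      × CountAtLeastRoot 10 (ReducedSquareCube ∩ LastTwoEqual)
  lastTwoEqual-family 0<c c<b =
    increasing⇒infinite {f = f} a₂ b-increasing f∈ ,
    family⇒countAtLeastRoot 10 C (λ a → reducedSquareCube? a ×-dec lastTwoEqual? a)
      {f = f} a₂ b-increasing f∈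
      (λ t → a≤ t , c≤ t , b≤ t , b≤ t)
    where
    f : ℕ → Tuple
    f t = a t , c t , b t , b t
    a₂ : Tuple → ℕ
    a₂ (_ , _ , a₂ , _) = a₂
    -- The smaller step `c` now comes first, whereas `cubeSquares` puts it last, so the bits are
    -- permuted.
    rotate : ∀ a b c i j k → a + j * b + k * b + i * c ≡ a + i * c + j * b + k * b
    rotate = solve-∀
    f∈ : ∀ t → (ReducedSquareCube ∩ LastTwoEqual) (f t)
    f∈ t =
      ( (0<c t , 0<b t , 0<b t)
      , commonDivisors≡1⇒reduced {a t} {c t} {b t} {b t}
          (λ i∣a i∣c i∣b _ → commonDivisor≡1′ t i∣a i∣b i∣c)
      , λ { (i , j , k , refl) →
            subst 𝒮 (rotate (a t) (b t) (c t) (toℕ i) (toℕ j) (toℕ k))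
              (cubeSquares (y t) (z t) (q≤r t) j k i) }) ,
      c<b t , refl

-- The two explicit families

infinitelyMany-firstTwoEqual :
  Infinite (ReducedSquareCube ∩ FirstTwoEqual)
    × CountAtLeastRoot 10 (ReducedSquareCube ∩ FirstTwoEqual)
infinitelyMany-firstTwoEqual =
  -- With z = 1, q = 2 y + 1 is linear and r = 3 y² + 2 y quadratic in y, so the gap dominates. The
  -- least y with 9 q ≤ r is 6, and increments of 2 keep y even.
  Family.firstTwoEqual-family y (λ _ → 1)
    (λ t → +-monoʳ-< 6 (*-monoʳ-< 2 (n<1+n t)))
    (λ _ → ≤-refl)
    (λ _ → s≤s z≤n)
    (λ _ → s≤s z≤n)
    (λ _ → s≤s z≤n)
    -- 21 is the value of 3 (1 + y) at t = 0.
    21 (s≤s (s≤s z≤n)) (λ t → ≤-trans (m≤m+n _ (15 * t)) (≤-reflexive (bound t)))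
    (λ _ (i∣1 , _) → ∣1⇒≡1 i∣1)
    (λ _ (i∣1 , _) → ∣1⇒≡1 i∣1)
    (λ t → divides (3 + t) (even t))
    (λ t → ≤-trans (m≤n+m _ (8 * q (y t) 1)) (9q≤r t))
    (λ t → diff<gap (y t) 1 (s≤s z≤n)
      (m+n≤o⇒m≤o∸n (8 * q (y t) 1) (9q≤r t)) (p<2r (2 * t)))
  where
  y : ℕ → ℕ
  y t = 6 + 2 * t
  even : ∀ t → 6 + 2 * t ≡ (3 + t) * 2
  even = solve-∀
  bound : ∀ t → 3 * (7 + 2 * t) + 15 * t ≡ 21 * suc t
  bound = solve-∀
  9q≤r : ∀ t → 8 * q (y t) 1 + q (y t) 1 ≤ r (y t) 1
  9q≤r t = ≤-trans (m≤m+n _ _) (≤-reflexive (identity (2 * t)))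
    where
    identity : ∀ u → 8 * (1 * (2 * (6 + u) + 1)) + 1 * (2 * (6 + u) + 1) + (3 + 20 * u + 3 * (u * u)) ≡
                     (6 + u) * (3 * (6 + u) + 2 * 1)
    identity = solve-∀
  -- The identity writes y as 1 + u, where the remainder has nonnegative coefficients, and is
  -- applied with 5 + u.
  p<2r : ∀ u → p (6 + u) 1 < 2 * r (6 + u) 1
  p<2r u = ≤-trans (m≤m+n _ _) (≤-reflexive (identity (5 + u)))
    where
    identity : ∀ u → 1 + (1 * (2 * (1 + u) + 1) + (1 + u) * (3 * (1 + u) + 1))
                       + (3 * (u * u) + 7 * u + 2) ≡
                     2 * ((1 + u) * (3 * (1 + u) + 2 * 1))
    identity = solve-∀

infinitelyMany-lastTwoEqual :
  Infinite (ReducedSquareCube ∩ LastTwoEqual)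
    × CountAtLeastRoot 10 (ReducedSquareCube ∩ LastTwoEqual)
infinitelyMany-lastTwoEqual =
  -- For z = y + 1 the ratios p : q : r approach 7 : 3 : 5, where the gap is the smaller step.
  -- Taking y = 4 + 6 t makes y even and z congruent to 2 modulo 3.
  Family.lastTwoEqual-family y (λ t → suc (y t))
    (λ t → +-monoʳ-< 4 (*-monoʳ-< 6 (n<1+n t)))
    (λ t → s≤s (+-monoʳ-≤ 4 (*-monoʳ-≤ 6 (n≤1+n t))))
    (λ _ → s≤s z≤n)
    (λ _ → s≤s z≤n)
    (λ _ → ≤-refl)
    21 (s≤s (s≤s z≤n)) (λ t → ≤-trans (m≤m+n _ (6 + 3 * t)) (≤-reflexive (bound t)))
    (λ t (i∣z , i∣y) → ∣1⇒≡1 (∣m+n∣n⇒∣m i∣z i∣y))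
    -- z + 1 = 6 + 6 t is a multiple of 3, so a common divisor of z and 3 divides 1.
    (λ t {i} (i∣z , i∣3) → ∣1⇒≡1 (∣m+n∣m⇒∣n (subst (i ∣_) (three t) (∣m⇒∣m*n (2 + 2 * t) i∣3)) i∣z))
    (λ t → divides (2 + 3 * t) (even t))
    (λ t → <⇒≤ (q<r t))
    (λ t → *-mono-< (*-mono-< (m<n⇒0<n∸m (q<r t)) (s≤s {0} z≤n)) (s≤s {0} z≤n))
    (λ t → gap<diff (y t) (suc (y t)) (s≤s z≤n) (s≤s z≤n)
      (2s≤v (y t)) (r≤2q (y t)) (2p<5q (y t)))
  where
  y : ℕ → ℕ
  y t = 4 + 6 * t
  even : ∀ t → 4 + 6 * t ≡ (2 + 3 * t) * 2
  even = solve-∀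
  three : ∀ t → 3 * (2 + 2 * t) ≡ 5 + 6 * t + 1
  three = solve-∀
  bound : ∀ t → 3 * (5 + 6 * t) + (6 + 3 * t) ≡ 21 * suc t
  bound = solve-∀
  q<r : ∀ t → q (y t) (suc (y t)) < r (y t) (suc (y t))
  q<r t = ≤-trans (m≤m+n _ _) (≤-reflexive (identity (2 + 6 * t)))
    where
    identity : ∀ u → 1 + (3 + u) * (2 * (2 + u) + (3 + u)) + (2 * (u * u) + 6 * u + 2) ≡
                     (2 + u) * (3 * (2 + u) + 2 * (3 + u))
    identity = solve-∀
  -- 2 (r - q) and v agree in their leading term 4 y²; the lower terms decide, leaving 2 q + v - 2 r
  -- = 5 y + 2.
  2s≤v : ∀ y → 2 * s y (suc y) ≤ v y (suc y)
  2s≤v y = begin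
    2 * (r y (suc y) ∸ q y (suc y))         ≡⟨ *-distribˡ-∸ 2 (r y (suc y)) (q y (suc y)) ⟩
    2 * r y (suc y) ∸ 2 * q y (suc y)       ≤⟨ m≤n+o⇒m∸n≤o _ (2 * q y (suc y)) 2r≤2q+v ⟩
    v y (suc y)                             ∎
    where
    open ≤-Reasoning
    identity : ∀ y → 2 * (y * (3 * y + 2 * suc y)) + (5 * y + 2) ≡
                     2 * (suc y * (2 * y + suc y)) + y * (3 * y + suc y)
    identity = solve-∀
    2r≤2q+v : 2 * r y (suc y) ≤ 2 * q y (suc y) + v y (suc y)
    2r≤2q+v = ≤-trans (m≤m+n _ (5 * y + 2)) (≤-reflexive (identity y))
  r≤2q : ∀ y → r y (suc y) ≤ 2 * q y (suc y)
  r≤2q y = ≤-trans (m≤m+n _ (y * y + 6 * y + 2)) (≤-reflexive (identity y))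
    where
    identity : ∀ y → y * (3 * y + 2 * suc y) + (y * y + 6 * y + 2) ≡ 2 * (suc y * (2 * y + suc y))
    identity = solve-∀
  -- To leading order the two sides are 14 y² and 15 y².
  2p<5q : ∀ y → 2 * p y (suc y) < 5 * q y (suc y)
  2p<5q y = ≤-trans (m≤m+n _ (y * y + 10 * y + 2)) (≤-reflexive (identity y))
    where
    identity : ∀ y → 1 + 2 * (suc y * (2 * y + suc y) + y * (3 * y + suc y)) + (y * y + 10 * y + 2) ≡
                     5 * (suc y * (2 * y + suc y))
    identity = solve-∀

theorem1p6 : (Infinite (ReducedSquareCube ∩ FirstTwoEqual)
    × CountAtLeastRoot 10 (ReducedSquareCube ∩ FirstTwoEqual))
    × (Infinite (ReducedSquareCube ∩ LastTwoEqual)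
    × CountAtLeastRoot 10 (ReducedSquareCube ∩ LastTwoEqual))
theorem1p6 = infinitelyMany-firstTwoEqual , infinitelyMany-lastTwoEqual
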